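{- Let $\mathcal{M}_1 = (V, \mathcal{I}_1)$ and $\mathcal{M}_2 = (V, \mathcal{I}_2)$ be two matroids on the same ground set $V$ with $|V| = n$, accessible only through independence oracles, and let $r$ be the maximum cardinality of a common independent set. For any $\varepsilon > 0$, there is a deterministic algorithm that finds a common independent set $S \in \mathcal{I}_1 \cap \mathcal{I}_2$ with $|S| \geq (2/3 - \varepsilon) r$, using $O(\frac{n}{\varepsilon} + r \log r)$ independence oracle queries.
   Context: A matroid $\mathcal{M} = (V,\mathcal{I})$ is given by a finite ground set $V$ and a nonempty family $\mathcal{I}\subseteq 2^V$ of independent sets satisfying the downward closure and augmentation properties. A common independent set of $\mathcal{M}_1,\mathcal{M}_2$ is a set in $\mathcal{I}_1 \cap \mathcal{I}_2$. An independence oracle for $\mathcal{M}_i$ takes as input a subset $S \subseteq V$ and answers whether $S \in \mathcal{I}_i$; each such call counts as one query. -}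

module Defs where

open import Data.Nat using (ℕ; zero; suc; _<_; _≤_)
open import Data.Bool using (Bool; true; false; T)
open import Data.Fin using (Fin)
open import Data.Fin.Subset using (Subset; ⊥; ⁅_⁆; _∈_; _∉_; _⊆_; _∪_; ∣_∣)
open import Data.Product using (Σ; ∃; _×_; _,_; proj₁; proj₂)
open import Data.Integer using (+_)
open import Data.Rational using (ℚ; Positive; _÷_; _*_; _+_; _-_; _/_)
open import Data.Rational.Properties using (pos⇒nonZero)
open import Data.Nat.Logarithm using (⌈log₂_⌉)

-- A matroid on the ground set V = Fin n.  The family of independent sets
-- is given by its (decidable) indicator function, which is exactly what an
-- independence oracle answers.
record Matroid (n : ℕ) : Set where
  field
    indep      : Subset n → Bool
    -- nonempty family (equivalently, under downward closure, ∅ ∈ I)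
    nonempty   : ∃ λ S → T (indep S)
    down-closed : ∀ {A B} → A ⊆ B → T (indep B) → T (indep A)
    augment    : ∀ {A B} → T (indep A) → T (indep B) → ∣ A ∣ < ∣ B ∣ →
                 ∃ λ x → x ∈ B × x ∉ A × T (indep (A ∪ ⁅ x ⁆))
open Matroid public

Common : ∀ {n} → Matroid n → Matroid n → Subset n → Set
Common M₁ M₂ S = T (indep M₁ S) × T (indep M₂ S)

IsMaxCommonSize : ∀ {n} → Matroid n → Matroid n → ℕ → Set
IsMaxCommonSize M₁ M₂ r =
  (∃ λ S → Common M₁ M₂ S × ∣ S ∣ ≡' r) × (∀ S → Common M₁ M₂ S → ∣ S ∣ ≤ r)
  where
  open import Relation.Binary.PropositionalEquality using () renaming (_≡_ to _≡'_)

-- Deterministic oracle algorithms on ground set Fin n, as decision trees.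
-- A node 'query b S k' asks the oracle of matroid M₁ (b = true) or
-- M₂ (b = false) whether S is independent, and continues with k applied
-- to the answer.  Internal computation is free; only queries are counted.
data OracleAlg (n : ℕ) : Set where
  output : Subset n → OracleAlg n
  query  : Bool → Subset n → (Bool → OracleAlg n) → OracleAlg n

run : ∀ {n} → OracleAlg n → (Subset n → Bool) → (Subset n → Bool) → Subset n
run (output S) o₁ o₂ = S
run (query true  S k) o₁ o₂ = run (k (o₁ S)) o₁ o₂
run (query false S k) o₁ o₂ = run (k (o₂ S)) o₁ o₂

queries : ∀ {n} → OracleAlg n → (Subset n → Bool) → (Subset n → Bool) → ℕ
queries (output S) o₁ o₂ = zero
queries (query true  S k) o₁ o₂ = suc (queries (k (o₁ S)) o₁ o₂)
queries (query false S k) o₁ o₂ = suc (queries (k (o₂ S)) o₁ o₂)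

ℕtoℚ : ℕ → ℚ
ℕtoℚ m = (+ m) / 1

divPos : (p q : ℚ) → Positive q → ℚ
divPos p q pos = (p ÷ q) {{pos⇒nonZero q {{pos}}}}

{-# OPTIONS --safe #-}

-- Let S be a greedy maximal common independent set.  The algorithm looks for
-- B₁, B₂ outside S and A ⊆ S of equal size with S ∪ B₁ ∈ I₁, S ∪ B₂ ∈ I₂,
-- (S ∖ A) ∪ B₁ ∈ I₂ and (S ∖ A) ∪ B₂ ∈ I₁; then (S ∖ A) ∪ B₁ ∪ B₂ is a common
-- independent set of size |S| + |B₂|.  Such a triple is improved in rounds: B₁ is
-- grown first, A is chosen to accommodate it, B₂ is grown against A, and the
-- elements of A that B₂ does not use are discarded for good into a set R.  Hence
-- |R| grows by |B₁| − |B₂| in every round, and since R ⊆ S this gap is at most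
-- |S| / k in one of the first k rounds.  With P = S ∖ (A ∪ R) the four independent
-- sets S ∪ B₁, S ∪ B₂, R ∪ B₁ and P ∪ B₂ then span every element twice (each in
-- its own matroid), so every common independent set O satisfies
-- 2|O| ≤ 3|S| + |B₁| + 2|B₂|, which is at most 3(|S| + |B₂|) + |S| / k.
-- A round costs O(n) queries and k = ⌊1/ε⌋ suffices.
module Submission where

open import Defs
open import Data.Nat using (ℕ)
open import Data.Fin.Subset using (∣_∣)
open import Data.Product using (∃; _×_; _,_; proj₂)
open import Data.Integer using (+_)
open import Data.Nat.Logarithm using (⌈log₂_⌉)

module AugmentingSets where

  open import Data.Bool using (Bool; true; false; T; _∧_; if_then_else_)
  open import Data.Bool.Properties using (T?)
  open import Data.Empty using (⊥-elim)
  open import Data.Fin using (Fin)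
  open import Data.Fin.Subset using (Subset; inside; outside; ⊥; ⊤; ⁅_⁆; _∈_; _∉_; _⊆_; _∪_; _∩_; ∁)
  open import Data.Fin.Subset.Properties
  import Data.Integer as ℤ
  open ℤ using (+[1+_])
  import Data.Integer.Properties as ℤ
  open import Data.List using (List; []; _∷_; length; filter; allFin)
  open import Data.List.Membership.Propositional using () renaming (_∈_ to _∈ₗ_)
  open import Data.List.Membership.Propositional.Properties using (∈-filter⁺; ∈-filter⁻; ∈-allFin)
  open import Data.List.Properties using (length-filter; length-tabulate)
  open import Data.List.Relation.Unary.Any using (here; there)
  open import Data.Nat using (zero; suc; _+_; _*_; _≤_; _<_; z≤n; s≤s; _≤ᵇ_; _≤?_; _/_; NonZero; >-nonZero)
  open import Data.Nat.Coprimality using (Coprime)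
  open import Data.Nat.DivMod using (_%_; m/n*n≤m; m≥n⇒m/n>0; m≡m%n+[m/n]*n; m%n<n)
  open import Data.Nat.Properties
  open import Data.Nat.Tactic.RingSolver using (solve-∀)
  import Data.Rational as ℚ
  open ℚ using (ℚ; Positive; mkℚ; toℚᵘ)
  import Data.Rational.Properties as ℚ
  import Data.Rational.Unnormalised as ℚᵘ
  open ℚᵘ using (mkℚᵘ)
  import Data.Rational.Unnormalised.Properties as ℚᵘ
  open import Data.Sum using (_⊎_; inj₁; inj₂; [_,_]′)
  open import Data.Vec using ([]; _∷_; tabulate)
  open import Data.Vec.Properties using (lookup∘tabulate; []=⇒lookup; lookup⇒[]=)
  open import Function using (_∘_; id)
  open import Relation.Binary.PropositionalEquality using (_≡_; refl; sym; trans; cong; subst)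
  open import Relation.Nullary using (Dec; yes; no; contradiction)
  open import Relation.Nullary.Decidable using (decidable-stable; does; dec-true; _→-dec_)

  private
    variable
      n : ℕ
      A B C : Subset n

  -- Finite subsets: inclusions and cardinalities

  ∪-lub : A ⊆ C → B ⊆ C → A ∪ B ⊆ C
  ∪-lub f g x∈ = [ f , g ]′ (x∈p∪q⁻ _ _ x∈)

  ∪-left : A ⊆ B → A ⊆ B ∪ C
  ∪-left f x∈ = x∈p∪q⁺ (inj₁ (f x∈))

  ∪-right : A ⊆ C → A ⊆ B ∪ C
  ∪-right f x∈ = x∈p∪q⁺ (inj₂ (f x∈))

  ∪-mono : ∀ {D : Subset n} → A ⊆ C → B ⊆ D → A ∪ B ⊆ C ∪ D
  ∪-mono f g = ∪-lub (∪-left f) (∪-right g)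

  ∪-assocˡ : A ∪ (B ∪ C) ⊆ (A ∪ B) ∪ C
  ∪-assocˡ = ∪-lub (∪-left (∪-left id)) (∪-lub (∪-left (∪-right id)) (∪-right id))

  ⁅⁆⊆ : ∀ {x : Fin n} → x ∈ A → ⁅ x ⁆ ⊆ A
  ⁅⁆⊆ {A = A} {x} x∈A y∈ = subst (_∈ A) (sym (x∈⁅y⁆⇒x≡y x y∈)) x∈A

  Disjoint : Subset n → Subset n → Set
  Disjoint A B = ∀ {x} → x ∈ A → x ∉ B

  ∣∪∣+∣∩∣ : (A B : Subset n) → ∣ A ∪ B ∣ + ∣ A ∩ B ∣ ≡ ∣ A ∣ + ∣ B ∣
  ∣∪∣+∣∩∣ [] [] = refl
  ∣∪∣+∣∩∣ (inside ∷ A) (inside ∷ B) rewrite +-suc ∣ A ∪ B ∣ ∣ A ∩ B ∣ | +-suc ∣ A ∣ ∣ B ∣ =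
    cong (suc ∘ suc) (∣∪∣+∣∩∣ A B)
  ∣∪∣+∣∩∣ (inside ∷ A) (outside ∷ B) = cong suc (∣∪∣+∣∩∣ A B)
  ∣∪∣+∣∩∣ (outside ∷ A) (inside ∷ B) rewrite +-suc ∣ A ∣ ∣ B ∣ = cong suc (∣∪∣+∣∩∣ A B)
  ∣∪∣+∣∩∣ (outside ∷ A) (outside ∷ B) = ∣∪∣+∣∩∣ A B

  ∣∪∣≤ : (A B : Subset n) → ∣ A ∪ B ∣ ≤ ∣ A ∣ + ∣ B ∣
  ∣∪∣≤ A B = ≤-trans (m≤m+n _ _) (≤-reflexive (∣∪∣+∣∩∣ A B))

  disjoint⇒∣∪∣≥ : Disjoint A B → ∣ A ∣ + ∣ B ∣ ≤ ∣ A ∪ B ∣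
  disjoint⇒∣∪∣≥ {n} {A} {B} A#B = ≤-trans (≤-reflexive (sym (∣∪∣+∣∩∣ A B)))
    (≤-trans (+-monoʳ-≤ ∣ A ∪ B ∣ ∣∩∣≤0) (≤-reflexive (+-identityʳ _)))
    where
    ∩⊆⊥ : A ∩ B ⊆ ⊥
    ∩⊆⊥ x∈ with x∈p∩q⁻ A B x∈
    ... | x∈A , x∈B = contradiction x∈B (A#B x∈A)
    ∣∩∣≤0 : ∣ A ∩ B ∣ ≤ 0
    ∣∩∣≤0 = ≤-trans (p⊆q⇒∣p∣≤∣q∣ ∩⊆⊥) (≤-reflexive (∣⊥∣≡0 n))

  -- Spanning in a matroid

  module _ (M : Matroid n) where

    Indep : Subset n → Set
    Indep A = T (indep M A)

    indep-⊥ : A ⊆ ⊥ → Indep A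
    indep-⊥ A⊆⊥ = down-closed M (⊥⊆ ∘ A⊆⊥) (proj₂ (nonempty M))

    -- For independent `J` this is membership in the closure; a dependent `J` spans everything. As
    -- an implication it is decidable and, by downward closure, monotone in `J`.
    Spans : Subset n → Fin n → Set
    Spans J x = Indep (J ∪ ⁅ x ⁆) → x ∈ J

    spans-mono : ∀ {x} → A ⊆ B → Spans A x → Spans B x
    spans-mono A⊆B sp ind = A⊆B (sp (down-closed M (∪-mono A⊆B id) ind))

    spans-∈ : ∀ {x} → x ∈ A → Spans A x
    spans-∈ x∈A _ = x∈A

    -- Were `B` larger, augmentation would supply an element of `B` outside `A` that `A` does not
    -- span.
    spanned⇒∣∣≤ : Indep A → Indep B → (∀ {x} → x ∈ B → Spans A x) → ∣ B ∣ ≤ ∣ A ∣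
    spanned⇒∣∣≤ {A} {B} iA iB sp = ≮⇒≥ λ A<B →
      let x , x∈B , x∉A , ind = augment M iA iB A<B in x∉A (sp x∈B ind)

    spans? : ∀ J x → Dec (Spans J x)
    spans? J x = T? _ →-dec (x ∈? J)

  -- Greedy growth with oracle queries

  Oracle : ℕ → Set
  Oracle n = Subset n → Bool

  answer : Oracle n → Oracle n → Bool → Oracle n
  answer o₁ o₂ true = o₁
  answer o₁ o₂ false = o₂

  record Terminates (alg : OracleAlg n) (o₁ o₂ : Oracle n) (Q : Subset n → Set) (m : ℕ) : Set where
    constructor _,_
    field
      result : Q (run alg o₁ o₂)
      cost   : queries alg o₁ o₂ ≤ m

  open Terminates

  terminates-query : ∀ b A {k} {o₁ o₂ : Oracle n} {Q m} →
    Terminates (k (answer o₁ o₂ b A)) o₁ o₂ Q m → Terminates (query b A k) o₁ o₂ Q (suc m)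
  terminates-query true A (q , ≤m) = q , s≤s ≤m
  terminates-query false A (q , ≤m) = q , s≤s ≤m

  -- The pair (b , U) asks of X that U ∪ X be independent in M₁ (b = true) or M₂ (b = false).
  Constraint : ℕ → Set
  Constraint n = Bool × Subset n

  -- Continuation-passing lets later stages depend on the set grown here. Both oracles are asked
  -- even after a first refusal, so each element costs exactly two queries.
  growList : Constraint n → Constraint n → List (Fin n) → Subset n →
    (Subset n → OracleAlg n) → OracleAlg n
  growList c d [] X k = k X
  growList c@(b , U) d@(b′ , U′) (v ∷ vs) X k =
    query b (U ∪ (X ∪ ⁅ v ⁆)) λ a → query b′ (U′ ∪ (X ∪ ⁅ v ⁆)) λ a′ →
    growList c d vs (if a ∧ a′ then X ∪ ⁅ v ⁆ else X) k

  elements : Subset n → List (Fin n)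
  elements Y = filter (_∈? Y) (allFin _)

  grow : Constraint n → Constraint n → Subset n → Subset n →
    (Subset n → OracleAlg n) → OracleAlg n
  grow c d Y = growList c d (elements Y)

  module _ (M₁ M₂ : Matroid n) where

    matroid : Bool → Matroid n
    matroid true = M₁
    matroid false = M₂

    Satisfies : Constraint n → Subset n → Set
    Satisfies (b , U) X = Indep (matroid b) (U ∪ X)

    -- `Y` is a predicate so that the induction on lists can use list membership. Maximality is
    -- joint: an element outside `Z` may still be compatible with either constraint alone.
    record Grown (c d : Constraint n) (Y : Fin n → Set) (X Z : Subset n) : Set where
      field
        lower    : X ⊆ Z
        upper    : ∀ {x} → x ∈ Z → x ∈ X ⊎ Y x
        sat₁     : Satisfies c Z
        sat₂     : Satisfies d Z
        maximal  : ∀ {y} → Y y → Satisfies c (Z ∪ ⁅ y ⁆) → Satisfies d (Z ∪ ⁅ y ⁆) → y ∈ Z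

    open Grown

    satisfies-⊆ : ∀ c {A B} → A ⊆ B → Satisfies c B → Satisfies c A
    satisfies-⊆ (b , U) A⊆B = down-closed (matroid b) (∪-mono id A⊆B)

    Terminates₂ : OracleAlg n → (Subset n → Set) → ℕ → Set
    Terminates₂ alg = Terminates alg (indep M₁) (indep M₂)

    answer≡ : ∀ b A → answer (indep M₁) (indep M₂) b A ≡ indep (matroid b) A
    answer≡ true A = refl
    answer≡ false A = refl

    growList-terminates : ∀ c d vs {X k Q m} → Satisfies c X → Satisfies d X →
      (∀ Z → Grown c d (_∈ₗ vs) X Z → Terminates₂ (k Z) Q m) →
      Terminates₂ (growList c d vs X k) Q (length vs * 2 + m)
    growList-terminates c d [] {X} sc sd post = post X record
      { lower = id ; upper = inj₁ ; sat₁ = sc ; sat₂ = sd ; maximal = λ () }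
    growList-terminates c@(b , U) d@(b′ , U′) (v ∷ vs) {X} {k} {Q} {m} sc sd post
      = terminates-query b _ (terminates-query b′ _ body)
      where
      p q : Bool
      p = answer (indep M₁) (indep M₂) b (U ∪ (X ∪ ⁅ v ⁆))
      q = answer (indep M₁) (indep M₂) b′ (U′ ∪ (X ∪ ⁅ v ⁆))
      reject : (Satisfies c (X ∪ ⁅ v ⁆) → Satisfies d (X ∪ ⁅ v ⁆) → v ∈ X) →
        Terminates₂ (growList c d vs X k) Q (length vs * 2 + m)
      reject no-v = growList-terminates c d vs sc sd λ Z g → post Z record
        { lower = lower g
        ; upper = λ x∈ → [ inj₁ , inj₂ ∘ there ]′ (upper g x∈)
        ; sat₁ = sat₁ g
        ; sat₂ = sat₂ g
        -- A refusal is final: the set only grows and both constraints are closed downwards.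
        ; maximal = λ { (here refl) s t → lower g (no-v (satisfies-⊆ c (∪-mono (lower g) id) s)
                                                       (satisfies-⊆ d (∪-mono (lower g) id) t))
                      ; (there y∈) → maximal g y∈ } }
      body : Terminates₂ (growList c d vs (if p ∧ q then X ∪ ⁅ v ⁆ else X) k) Q (length vs * 2 + m)
      body with p in eqp | q in eqq
      ... | false | _ = reject λ s _ → ⊥-elim (subst T (trans (sym (answer≡ b _)) eqp) s)
      ... | true | false = reject λ _ t → ⊥-elim (subst T (trans (sym (answer≡ b′ _)) eqq) t)
      ... | true | true = growList-terminates c d vs
        (subst T (trans (sym eqp) (answer≡ b _)) _) (subst T (trans (sym eqq) (answer≡ b′ _)) _)
        λ Z g → post Z record
        { lower = lower g ∘ ∪-left id
        ; upper = λ x∈ → [ [ inj₁ , (λ x∈v → inj₂ (here (x∈⁅y⁆⇒x≡y v x∈v))) ]′ ∘ x∈p∪q⁻ X _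
                         , inj₂ ∘ there ]′ (upper g x∈)
        ; sat₁ = sat₁ g
        ; sat₂ = sat₂ g
        ; maximal = λ { (here refl) _ _ → lower g (∪-right id (x∈⁅x⁆ v))
                      ; (there y∈) → maximal g y∈ } }

    grow-terminates : ∀ c d Y {X k Q m} → Satisfies c X → Satisfies d X →
      (∀ Z → Grown c d (_∈ Y) X Z → Terminates₂ (k Z) Q m) →
      Terminates₂ (grow c d Y X k) Q (n * 2 + m)
    grow-terminates c d Y {m = m} sc sd post =
      let t = growList-terminates c d (elements Y) sc sd λ Z g → post Z record
            { lower = lower g
            ; upper = λ x∈ → [ inj₁ , inj₂ ∘ proj₂ ∘ ∈-filter⁻ (_∈? Y) {xs = allFin n} ]′ (upper g x∈)
            ; sat₁ = sat₁ g
            ; sat₂ = sat₂ g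
            ; maximal = λ y∈ → maximal g (∈-filter⁺ (_∈? Y) (∈-allFin _) y∈) }
      in result t , ≤-trans (cost t) (+-monoˡ-≤ m (*-monoˡ-≤ 2
               (≤-trans (length-filter (_∈? Y) (allFin n)) (≤-reflexive (length-tabulate {n = n} id)))))

    -- Running the greedy procedure also serves as the existence proof for maximal sets.
    grown : ∀ c d Y {X} → Satisfies c X → Satisfies d X → ∃ (Grown c d (_∈ Y) X)
    grown c d Y sc sd = _ ,
      result (grow-terminates c d Y {k = output} {m = 0} sc sd λ Z g → g , z≤n)

  open Grown

  module _ {M₁ M₂ : Matroid n} where

    grown-⊥-⊆ : ∀ {c d Y Z} → Grown M₁ M₂ c d (_∈ Y) ⊥ Z → Z ⊆ Y
    grown-⊥-⊆ g x∈ = [ (λ x∈⊥ → contradiction x∈⊥ ∉⊥) , id ]′ (upper g x∈)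

    grown-spans : ∀ {b U Y X Z} → Grown M₁ M₂ (b , U) (b , U) Y X Z →
      ∀ {x} → Y x → Spans (matroid M₁ M₂ b) (U ∪ Z) x
    grown-spans {b} g y i = ∪-right id (maximal g y i′ i′)
      where i′ = down-closed (matroid M₁ M₂ b) ∪-assocˡ i

  -- Matroid exchange, and double counting with closures

  module _ (M : Matroid n) where

    extend : ∀ {Y} B → Indep M Y → ∃ λ N →
      N ⊆ B × Indep M (Y ∪ N) × (∀ {x} → x ∈ B → Spans M (Y ∪ N) x)
    extend {Y} B iY =
      let N , g = grown M M (true , Y) (true , Y) B {⊥} iY⊥ iY⊥
      in N , grown-⊥-⊆ g , sat₁ g , grown-spans g
      where
      iY⊥ = down-closed M (∪-lub id ⊥⊆) iY

    -- Y ⊆ cl X, so contracting Y leaves B independent because contracting X does.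
    exchange : ∀ {X Y B} → Indep M (X ∪ B) → Disjoint X B → Indep M Y →
      (∀ {y} → y ∈ Y → Spans M X y) → Indep M (Y ∪ B)
    exchange {X} {Y} {B} iXB X#B iY sp =
      let N , N⊆X , iZ , X-spanned = extend X iY
          L , L⊆B , iW , B-spanned = extend B iZ
          iX = down-closed M (∪-left id) iXB
          Z≤X : ∣ Y ∪ N ∣ ≤ ∣ X ∣
          Z≤X = spanned⇒∣∣≤ M iX iZ λ x∈ → [ sp , spans-∈ M ∘ N⊆X ]′ (x∈p∪q⁻ Y N x∈)
          -- `(Y ∪ N) ∪ L` spans `X` and `B`, while `Y ∪ N` is no larger than `X`; this forces `L`
          -- to be all of `B`.
          XB≤W : ∣ X ∣ + ∣ B ∣ ≤ ∣ (Y ∪ N) ∪ L ∣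
          XB≤W = ≤-trans (disjoint⇒∣∪∣≥ X#B) (spanned⇒∣∣≤ M iW iXB λ x∈ →
            [ spans-mono M (∪-left id) ∘ X-spanned , B-spanned ]′ (x∈p∪q⁻ X B x∈))
          B≤L : ∣ B ∣ ≤ ∣ L ∣
          B≤L = +-cancelˡ-≤ ∣ X ∣ _ _
            (≤-trans XB≤W (≤-trans (∣∪∣≤ (Y ∪ N) L) (+-monoˡ-≤ ∣ L ∣ Z≤X)))
          B⊆L : B ⊆ L
          B⊆L {b} b∈B = decidable-stable (b ∈? L) λ b∉L →
            <-irrefl refl (≤-trans (p⊂q⇒∣p∣<∣q∣ (L⊆B , b , b∈B , b∉L)) B≤L)
      in down-closed M (∪-mono (∪-left id) B⊆L) iW

  -- Each element of `O` is counted at least twice: it lies in `A` or `C`, and moreover in both of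
  -- these or in `B` or `D`.
  double-cover : ∀ {O : Subset n} A B C D → O ⊆ A ∪ C → O ⊆ (A ∩ C) ∪ (B ∪ D) →
    2 * ∣ O ∣ ≤ (∣ A ∣ + ∣ B ∣) + (∣ C ∣ + ∣ D ∣)
  double-cover {O = O} A B C D once twice = begin
    2 * ∣ O ∣                                      ≡⟨ cong (λ x → ∣ O ∣ + x) (+-identityʳ (∣ O ∣)) ⟩
    ∣ O ∣ + ∣ O ∣                                  ≤⟨ +-mono-≤ (p⊆q⇒∣p∣≤∣q∣ once) (p⊆q⇒∣p∣≤∣q∣ twice) ⟩
    ∣ A ∪ C ∣ + ∣ (A ∩ C) ∪ (B ∪ D) ∣              ≤⟨ +-monoʳ-≤ ∣ A ∪ C ∣ (≤-trans (∣∪∣≤ (A ∩ C) (B ∪ D))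
                                                        (+-monoʳ-≤ ∣ A ∩ C ∣ (∣∪∣≤ B D))) ⟩
    ∣ A ∪ C ∣ + (∣ A ∩ C ∣ + (∣ B ∣ + ∣ D ∣))      ≡⟨ +-assoc ∣ A ∪ C ∣ ∣ A ∩ C ∣ _ ⟨
    (∣ A ∪ C ∣ + ∣ A ∩ C ∣) + (∣ B ∣ + ∣ D ∣)      ≡⟨ cong (_+ (∣ B ∣ + ∣ D ∣)) (∣∪∣+∣∩∣ A C) ⟩
    (∣ A ∣ + ∣ C ∣) + (∣ B ∣ + ∣ D ∣)              ≡⟨ interchange (∣ A ∣) (∣ C ∣) (∣ B ∣) (∣ D ∣) ⟩
    (∣ A ∣ + ∣ B ∣) + (∣ C ∣ + ∣ D ∣)              ∎
    where
    open ≤-Reasoning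
    interchange : ∀ a c b d → (a + c) + (b + d) ≡ (a + b) + (c + d)
    interchange = solve-∀

  module _ (M : Matroid n) where

    closure : Subset n → Subset n
    closure J = tabulate λ x → does (spans? M J x)

    spans⇒∈closure : ∀ {J x} → Spans M J x → x ∈ closure J
    spans⇒∈closure {J} {x} sp = lookup⇒[]= x _ (trans (lookup∘tabulate _ x) (dec-true (spans? M J x) sp))

    ∈closure⇒spans : ∀ {J x} → x ∈ closure J → Spans M J x
    ∈closure⇒spans {J} {x} x∈ =
      witness (spans? M J x) (trans (sym (lookup∘tabulate _ x)) ([]=⇒lookup x∈))
      where
      witness : ∀ {P : Set} (P? : Dec P) → does P? ≡ true → P
      witness (yes p) _ = p
      witness (no _) ()

    ∣∩closure∣≤ : ∀ {O J} → Indep M O → Indep M J → ∣ O ∩ closure J ∣ ≤ ∣ J ∣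
    ∣∩closure∣≤ {O} {J} iO iJ = spanned⇒∣∣≤ M iJ (down-closed M (p∩q⊆p O _) iO)
      λ x∈ → ∈closure⇒spans (proj₂ (x∈p∩q⁻ O _ x∈))

  -- Augmenting triples over a maximal common independent set

  module FromMaximal (M₁ M₂ : Matroid n) {S : Subset n} (iS₁ : Indep M₁ S) (iS₂ : Indep M₂ S)
    (S-maximal : ∀ {y} → Indep M₁ (S ∪ ⁅ y ⁆) → Indep M₂ (S ∪ ⁅ y ⁆) → y ∈ S) where

    spans₂ : Indep M₁ (S ∪ B) → ∀ {y} → y ∈ B → Spans M₂ S y
    spans₂ iSB y∈B = S-maximal (down-closed M₁ (∪-mono id (⁅⁆⊆ y∈B)) iSB)

    spans₁ : Indep M₂ (S ∪ B) → ∀ {y} → y ∈ B → Spans M₁ S y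
    spans₁ iSB y∈B i₁ = S-maximal i₁ (down-closed M₂ (∪-mono id (⁅⁆⊆ y∈B)) iSB)

    -- In the notation of the introduction P = S ∖ (A ∪ R).  K witnesses that B₁ can
    -- replace A in M₂; blocked says that the discarded set R cannot help B₂ to grow.
    record State (P R B₁ B₂ : Subset n) : Set where
      field
        P⊆S     : P ⊆ S
        R⊆S     : R ⊆ S
        P#R     : Disjoint P R
        S#B₁    : Disjoint S B₁
        S#B₂    : Disjoint S B₂
        iSB₁    : Indep M₁ (S ∪ B₁)
        iSB₂    : Indep M₂ (S ∪ B₂)
        {K}     : Subset n
        iK      : Indep M₂ K
        K⊆      : K ⊆ (P ∪ R) ∪ B₁
        ∣S∣≤∣K∣ : ∣ S ∣ ≤ ∣ K ∣
        iPB₂R   : Indep M₁ ((P ∪ B₂) ∪ R)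
        blocked : ∀ {y} → y ∉ S → Indep M₂ (S ∪ (B₂ ∪ ⁅ y ⁆)) → Spans M₁ (P ∪ B₂) y

    initial : State S ⊥ ⊥ ⊥
    initial = record
      { P⊆S = id
      ; R⊆S = ⊥⊆
      ; P#R = λ _ → ∉⊥
      ; S#B₁ = λ _ → ∉⊥
      ; S#B₂ = λ _ → ∉⊥
      ; iSB₁ = down-closed M₁ (∪-lub id ⊥⊆) iS₁
      ; iSB₂ = down-closed M₂ (∪-lub id ⊥⊆) iS₂
      ; iK = iS₂
      ; K⊆ = ∪-left (∪-left id)
      ; ∣S∣≤∣K∣ = ≤-refl
      ; iPB₂R = down-closed M₁ (∪-lub (∪-lub id ⊥⊆) ⊥⊆) iS₁
      ; blocked = λ y∉S i₂ i₁ → contradiction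
          (S-maximal (down-closed M₁ (∪-mono (∪-left id) id) i₁) (down-closed M₂ (∪-mono id (∪-right id)) i₂)) y∉S
      }

    -- One round of improvement

    module Round {P R B₁ B₂ : Subset n} (state : State P R B₁ B₂) where

      open State state

      start-a : Indep M₂ ((P ∪ R) ∪ ⊥)
      start-a = down-closed M₂ (∪-lub (∪-lub P⊆S R⊆S) ⊥⊆) iS₂

      module _ {A₁ : Subset n}
        (grown-a : Grown M₁ M₂ (false , P ∪ R) (false , P ∪ R) (_∈ B₁) ⊥ A₁) where

        A₁⊆B₁ : A₁ ⊆ B₁
        A₁⊆B₁ = grown-⊥-⊆ grown-a

        -- By maximality of `A₁` inside `B₁`, the set on the right spans all of `(P ∪ R) ∪ B₁`,
        -- hence the independent set `K`.
        ∣S∣≤PRA₁ : ∣ S ∣ ≤ ∣ (P ∪ R) ∪ A₁ ∣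
        ∣S∣≤PRA₁ = ≤-trans ∣S∣≤∣K∣ (spanned⇒∣∣≤ M₂ (sat₁ grown-a) iK λ x∈K →
          [ spans-∈ M₂ ∘ ∪-left id , grown-spans grown-a ]′ (x∈p∪q⁻ (P ∪ R) B₁ (K⊆ x∈K)))

        start-b₁ : Indep M₁ (S ∪ A₁)
        start-b₁ = down-closed M₁ (∪-mono id A₁⊆B₁) iSB₁

        -- `P` is left out of this constraint: its elements may still move into the new `A` to make
        -- room for `B₁′`, whereas `R` must stay.
        start-b₂ : Indep M₂ (R ∪ A₁)
        start-b₂ = down-closed M₂ (∪-mono (∪-right id) id) (sat₁ grown-a)

        -- `exchange` trades `S` for `(P ∪ B₂) ∪ R`, which `S` spans in `M₁`: for `B₂` this follows
        -- from independence of `S ∪ B₂` in `M₂` and maximality of `S`. `augmented₂` argues likewise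
        -- with the matroids swapped.
        augmented₁ : Indep M₁ (((P ∪ B₂) ∪ R) ∪ A₁)
        augmented₁ = exchange M₁ start-b₁ (λ x∈S → S#B₁ x∈S ∘ A₁⊆B₁) iPB₂R λ y∈ →
          [ [ spans-∈ M₁ ∘ P⊆S , spans₁ iSB₂ ]′ ∘ x∈p∪q⁻ P B₂ , spans-∈ M₁ ∘ R⊆S ]′ (x∈p∪q⁻ (P ∪ B₂) R y∈)

        augmented₂ : Indep M₂ (((P ∪ R) ∪ A₁) ∪ B₂)
        augmented₂ = exchange M₂ iSB₂ S#B₂ (sat₁ grown-a) λ y∈ →
          [ spans-∈ M₂ ∘ ∪-lub P⊆S R⊆S , spans₂ start-b₁ ]′ (x∈p∪q⁻ (P ∪ R) A₁ y∈)

        augmented-common : Common M₁ M₂ (((P ∪ R) ∪ A₁) ∪ B₂)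
        augmented-common =
          down-closed M₁ (∪-lub (∪-lub (∪-lub (∪-left (∪-left (∪-left id))) (∪-left (∪-right id))) (∪-right id))
            (∪-left (∪-left (∪-right id)))) augmented₁ , augmented₂

        -- An element of both `A₁` and `B₂` could be added to `S` in either matroid, so it would lie
        -- in `S`, against `S#B₂`. Hence the union is disjoint.
        ∣augmented∣≥ : ∣ S ∣ + ∣ B₂ ∣ ≤ ∣ ((P ∪ R) ∪ A₁) ∪ B₂ ∣
        ∣augmented∣≥ = ≤-trans (+-monoˡ-≤ ∣ B₂ ∣ ∣S∣≤PRA₁) (disjoint⇒∣∪∣≥ λ x∈ x∈B₂ →
          S#B₂ ([ ∪-lub P⊆S R⊆S , (λ x∈A₁ → spans₂ start-b₁ x∈A₁
                  (down-closed M₂ (∪-mono id (⁅⁆⊆ x∈B₂)) iSB₂)) ]′ (x∈p∪q⁻ (P ∪ R) A₁ x∈)) x∈B₂)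

        module _ {B₁′ : Subset n}
          (grown-b : Grown M₁ M₂ (true , S) (false , R) (_∈ ∁ S) A₁ B₁′) where

          S#B₁′ : Disjoint S B₁′
          S#B₁′ x∈S x∈ = [ S#B₁ x∈S ∘ A₁⊆B₁ , x∈p⇒x∉∁p x∈S ]′ (upper grown-b x∈)

          start-c : Indep M₂ ((R ∪ B₁′) ∪ ⊥)
          start-c = down-closed M₂ (∪-lub id ⊥⊆) (sat₂ grown-b)

          module _ {P′ : Subset n}
            (grown-c : Grown M₁ M₂ (false , R ∪ B₁′) (false , R ∪ B₁′) (_∈ P) ⊥ P′) where

            P′⊆P : P′ ⊆ P
            P′⊆P = grown-⊥-⊆ grown-c

            -- `P′` is maximal in `P`, so the set on the right spans `P`, and it contains `R` and
            -- `A₁`. It becomes the next `K`.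
            ∣S∣≤RB₁′P′ : ∣ S ∣ ≤ ∣ (R ∪ B₁′) ∪ P′ ∣
            ∣S∣≤RB₁′P′ = ≤-trans ∣S∣≤PRA₁ (spanned⇒∣∣≤ M₂ (sat₁ grown-c) (sat₁ grown-a) λ x∈ →
              [ [ grown-spans grown-c , spans-∈ M₂ ∘ ∪-left (∪-left id) ]′ ∘ x∈p∪q⁻ P R
              , spans-∈ M₂ ∘ ∪-left (∪-right (lower grown-b))
              ]′ (x∈p∪q⁻ (P ∪ R) A₁ x∈))

            -- The three sets are disjoint, and their union is independent in `M₂` and spanned there
            -- by `S`.
            sizes-c : (∣ R ∣ + ∣ B₁′ ∣) + ∣ P′ ∣ ≤ ∣ S ∣
            sizes-c = begin
              (∣ R ∣ + ∣ B₁′ ∣) + ∣ P′ ∣ ≤⟨ +-monoˡ-≤ ∣ P′ ∣ (disjoint⇒∣∪∣≥ (S#B₁′ ∘ R⊆S)) ⟩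
              ∣ R ∪ B₁′ ∣ + ∣ P′ ∣       ≤⟨ disjoint⇒∣∪∣≥ (λ x∈ x∈P′ → [ P#R (P′⊆P x∈P′) , S#B₁′ (P⊆S (P′⊆P x∈P′)) ]′
                                              (x∈p∪q⁻ R B₁′ x∈)) ⟩
              ∣ (R ∪ B₁′) ∪ P′ ∣         ≤⟨ spanned⇒∣∣≤ M₂ iS₂ (sat₁ grown-c) (λ x∈ →
                                              [ [ spans-∈ M₂ ∘ R⊆S , spans₂ (sat₁ grown-b) ]′ ∘ x∈p∪q⁻ R B₁′
                                              , spans-∈ M₂ ∘ P⊆S ∘ P′⊆P ]′ (x∈p∪q⁻ (R ∪ B₁′) P′ x∈)) ⟩
              ∣ S ∣                      ∎
              where open ≤-Reasoning

            start-d : Indep M₁ (P′ ∪ B₂)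
            start-d = down-closed M₁ (∪-left (∪-mono P′⊆P id)) iPB₂R

            module _ {B₂′ : Subset n}
              (grown-d : Grown M₁ M₂ (false , S) (true , P′) (_∈ ∁ S) B₂ B₂′) where

              S#B₂′ : Disjoint S B₂′
              S#B₂′ x∈S x∈ = [ S#B₂ x∈S , x∈p⇒x∉∁p x∈S ]′ (upper grown-d x∈)

              -- `B₂′` is grown against `P′` alone, yet `R` still fits: `blocked` shows that
              -- `P ∪ B₂` spans `B₂′`, so `exchange` can replace it by `P′ ∪ B₂′` beside `R`.
              start-e : Indep M₁ ((P′ ∪ B₂′) ∪ R)
              start-e = exchange M₁ iPB₂R
                (λ x∈ x∈R → [ (λ x∈P → P#R x∈P x∈R) , S#B₂ (R⊆S x∈R) ]′ (x∈p∪q⁻ P B₂ x∈))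
                (sat₂ grown-d)
                λ y∈ → [ spans-∈ M₁ ∘ ∪-left P′⊆P
                       , (λ y∈B₂′ → blocked (λ y∈S → S#B₂′ y∈S y∈B₂′)
                           (down-closed M₂ (∪-mono id (∪-lub (lower grown-d) (⁅⁆⊆ y∈B₂′))) (sat₁ grown-d)))
                       ]′ (x∈p∪q⁻ P′ B₂′ y∈)

              certificate : ∀ O → Common M₁ M₂ O → 2 * ∣ O ∣ ≤ 3 * ∣ S ∣ + (∣ B₁′ ∣ + 2 * ∣ B₂′ ∣)
              certificate O (iO₁ , iO₂) = begin
                2 * ∣ O ∣
                  ≤⟨ double-cover (L M₁ (S ∪ B₁′)) (L M₂ (R ∪ B₁′)) (L M₂ (S ∪ B₂′)) (L M₁ (P′ ∪ B₂′)) once twice ⟩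
                (∣ L M₁ (S ∪ B₁′) ∣ + ∣ L M₂ (R ∪ B₁′) ∣) + (∣ L M₂ (S ∪ B₂′) ∣ + ∣ L M₁ (P′ ∪ B₂′) ∣)
                  ≤⟨ +-mono-≤ (+-mono-≤ (bound M₁ S B₁′ iO₁ (sat₁ grown-b)) (bound M₂ R B₁′ iO₂ (sat₂ grown-b)))
                              (+-mono-≤ (bound M₂ S B₂′ iO₂ (sat₁ grown-d)) (bound M₁ P′ B₂′ iO₁ (sat₂ grown-d))) ⟩
                ((∣ S ∣ + ∣ B₁′ ∣) + (∣ R ∣ + ∣ B₁′ ∣)) + ((∣ S ∣ + ∣ B₂′ ∣) + (∣ P′ ∣ + ∣ B₂′ ∣))
                  ≡⟨ regroup (∣ S ∣) (∣ B₁′ ∣) (∣ R ∣) (∣ B₂′ ∣) (∣ P′ ∣) ⟩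
                -- `sizes-c` absorbs `R`, one copy of `B₁′` and `P′` into a third copy of `S`.
                (2 * ∣ S ∣ + (∣ B₁′ ∣ + 2 * ∣ B₂′ ∣)) + ((∣ R ∣ + ∣ B₁′ ∣) + ∣ P′ ∣)
                  ≤⟨ +-monoʳ-≤ _ sizes-c ⟩
                (2 * ∣ S ∣ + (∣ B₁′ ∣ + 2 * ∣ B₂′ ∣)) + ∣ S ∣
                  ≡⟨ collect (∣ S ∣) _ ⟩
                3 * ∣ S ∣ + (∣ B₁′ ∣ + 2 * ∣ B₂′ ∣) ∎
                where
                open ≤-Reasoning
                L : Matroid n → Subset n → Subset n
                L M J = O ∩ closure M J
                bound : ∀ M J B → Indep M O → Indep M (J ∪ B) → ∣ L M (J ∪ B) ∣ ≤ ∣ J ∣ + ∣ B ∣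
                bound M J B iO iJB = ≤-trans (∣∩closure∣≤ M iO iJB) (∣∪∣≤ J B)
                regroup : ∀ s b r c p → ((s + b) + (r + b)) + ((s + c) + (p + c)) ≡ (2 * s + (b + 2 * c)) + ((r + b) + p)
                regroup = solve-∀
                collect : ∀ s x → (2 * s + x) + s ≡ 3 * s + x
                collect = solve-∀
                ∈L : ∀ {M J x} → x ∈ O → Spans M J x → x ∈ L M J
                ∈L {M} x∈O sp = x∈p∩q⁺ (x∈O , spans⇒∈closure M sp)
                -- If `Spans M₂ S x` fails, its premise holds, and `S-maximal` then yields the
                -- implication for `M₁`.
                either : ∀ x → Spans M₁ S x ⊎ Spans M₂ S x
                either x with spans? M₂ S x | T? (indep M₂ (S ∪ ⁅ x ⁆))
                ... | yes sp | _ = inj₂ sp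
                ... | no _   | yes i₂ = inj₁ λ i₁ → S-maximal i₁ i₂
                ... | no ¬sp | no ¬i₂ = contradiction (⊥-elim ∘ ¬i₂) ¬sp
                -- Joint maximality only excludes both independences at once; deciding the first
                -- tells which matroid does the spanning.
                or-spans : ∀ {N₁ N₂ : Matroid n} {J₁ J₂ B x} →
                  (Indep N₁ (J₁ ∪ (B ∪ ⁅ x ⁆)) → Indep N₂ (J₂ ∪ (B ∪ ⁅ x ⁆)) → x ∈ B) →
                  Spans N₁ (J₁ ∪ B) x ⊎ Spans N₂ (J₂ ∪ B) x
                or-spans {N₁} {N₂} {J₁} {J₂} {B} {x} f with T? (indep N₁ (J₁ ∪ (B ∪ ⁅ x ⁆)))
                ... | yes i₁ = inj₂ λ i₂ → ∪-right id (f i₁ (down-closed N₂ ∪-assocˡ i₂))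
                ... | no ¬i₁ = inj₁ λ i₁ → contradiction (down-closed N₁ ∪-assocˡ i₁) ¬i₁
                once : O ⊆ L M₁ (S ∪ B₁′) ∪ L M₂ (S ∪ B₂′)
                once {x} x∈O = x∈p∪q⁺ ([ (λ sp → inj₁ (∈L {M₁} x∈O (spans-mono M₁ (∪-left id) sp)))
                                       , (λ sp → inj₂ (∈L {M₂} x∈O (spans-mono M₂ (∪-left id) sp))) ]′ (either x))
                -- Outside `S`, if `S` spans `x` in `M₁` then maximality of `B₂′` yields the second
                -- span; if in `M₂`, maximality of `B₁′` does.
                case-x : ∀ {x} → x ∈ O → Spans M₁ (S ∪ B₁′) x × Spans M₂ (S ∪ B₂′) x
                       ⊎ Spans M₂ (R ∪ B₁′) x ⊎ Spans M₁ (P′ ∪ B₂′) x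
                case-x {x} x∈O with x ∈? S | either x
                ... | yes x∈S | _ = inj₁ (spans-∈ M₁ (∪-left id x∈S) , spans-∈ M₂ (∪-left id x∈S))
                ... | no x∉S | inj₁ sp = [ (λ sp₂ → inj₁ (spans-mono M₁ (∪-left id) sp , sp₂)) , inj₂ ∘ inj₂ ]′
                                           (or-spans {M₂} {M₁} (maximal grown-d (x∉p⇒x∈∁p x∉S)))
                ... | no x∉S | inj₂ sp = [ (λ sp₁ → inj₁ (sp₁ , spans-mono M₂ (∪-left id) sp)) , inj₂ ∘ inj₁ ]′
                                           (or-spans {M₁} {M₂} (maximal grown-b (x∉p⇒x∈∁p x∉S)))
                twice : O ⊆ (L M₁ (S ∪ B₁′) ∩ L M₂ (S ∪ B₂′)) ∪ (L M₂ (R ∪ B₁′) ∪ L M₁ (P′ ∪ B₂′))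
                twice x∈O = [ (λ (sp₁ , sp₂) → x∈p∪q⁺ (inj₁ (x∈p∩q⁺ (∈L {M₁} x∈O sp₁ , ∈L {M₂} x∈O sp₂))))
                            , (λ sp → x∈p∪q⁺ (inj₂ (x∈p∪q⁺ ([ inj₁ ∘ ∈L {M₂} x∈O , inj₂ ∘ ∈L {M₁} x∈O ]′ sp)))) ]′ (case-x x∈O)

              module _ {R′ : Subset n}
                (grown-e : Grown M₁ M₂ (true , P′ ∪ B₂′) (true , P′ ∪ B₂′) (_∈ S ∩ ∁ P′) R R′) where

                next : State P′ R′ B₁′ B₂′
                next = record
                  { P⊆S = P⊆S ∘ P′⊆P
                  ; R⊆S = λ x∈ → [ R⊆S , p∩q⊆p S (∁ P′) ]′ (upper grown-e x∈)
                  ; P#R = λ x∈P′ x∈ → [ P#R (P′⊆P x∈P′) , x∈p⇒x∉∁p x∈P′ ∘ p∩q⊆q S (∁ P′) ]′ (upper grown-e x∈)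
                  ; S#B₁ = S#B₁′
                  ; S#B₂ = S#B₂′
                  ; iSB₁ = sat₁ grown-b
                  ; iSB₂ = sat₁ grown-d
                  ; iK = sat₁ grown-c
                  ; K⊆ = ∪-lub (∪-mono (∪-right (lower grown-e)) id) (∪-left (∪-left id))
                  ; ∣S∣≤∣K∣ = ∣S∣≤RB₁′P′
                  ; iPB₂R = sat₁ grown-e
                  ; blocked = λ y∉S i₂ i₁ → ∪-right id
                      (maximal grown-d (x∉p⇒x∈∁p y∉S) i₂ (down-closed M₁ ∪-assocˡ i₁))
                  }

                -- Maximality of `R′` makes `(P′ ∪ B₂′) ∪ R′` span `S` in `M₁`, so it has at least
                -- `∣ S ∣` elements. Against `sizes-c`, `P′` cancels.
                progress : ∣ R ∣ + ∣ B₁′ ∣ ≤ ∣ R′ ∣ + ∣ B₂′ ∣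
                progress = +-cancelʳ-≤ ∣ P′ ∣ _ _ (begin
                  (∣ R ∣ + ∣ B₁′ ∣) + ∣ P′ ∣     ≤⟨ sizes-c ⟩
                  ∣ S ∣                          ≤⟨ spanned⇒∣∣≤ M₁ (sat₁ grown-e) iS₁ S-spanned ⟩
                  ∣ (P′ ∪ B₂′) ∪ R′ ∣            ≤⟨ ≤-trans (∣∪∣≤ (P′ ∪ B₂′) R′) (+-monoˡ-≤ ∣ R′ ∣ (∣∪∣≤ P′ B₂′)) ⟩
                  (∣ P′ ∣ + ∣ B₂′ ∣) + ∣ R′ ∣    ≡⟨ rotate (∣ P′ ∣) (∣ B₂′ ∣) (∣ R′ ∣) ⟩
                  (∣ R′ ∣ + ∣ B₂′ ∣) + ∣ P′ ∣    ∎)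
                  where
                  open ≤-Reasoning
                  rotate : ∀ p b r → (p + b) + r ≡ (r + b) + p
                  rotate = solve-∀
                  S-spanned : ∀ {x} → x ∈ S → Spans M₁ ((P′ ∪ B₂′) ∪ R′) x
                  S-spanned {x} x∈S with x ∈? P′
                  ... | yes x∈P′ = spans-∈ M₁ (∪-left (∪-left id) x∈P′)
                  ... | no x∉P′ = grown-spans grown-e (x∈p∩q⁺ (x∈S , x∉p⇒x∈∁p x∉P′))

  -- The algorithm and its arithmetic

  finish : (P R B₁ B₂ : Subset n) → OracleAlg n
  -- `B₁` may exceed what `M₂` accommodates beside `P ∪ R`, so it is cut down before the output.
  finish P R B₁ B₂ = grow (false , P ∪ R) (false , P ∪ R) B₁ ⊥ λ A₁ →
    output (((P ∪ R) ∪ A₁) ∪ B₂)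

  rounds : (k fuel : ℕ) (S P R B₁ B₂ : Subset n) → OracleAlg n
  rounds k zero S P R B₁ B₂ = output ⊥  -- never reached: see budget-step
  rounds k (suc f) S P R B₁ B₂ =
    grow (false , P ∪ R) (false , P ∪ R) B₁ ⊥ λ A₁ →
    grow (true , S) (false , R) (∁ S) A₁ λ B₁′ →
    grow (false , R ∪ B₁′) (false , R ∪ B₁′) P ⊥ λ P′ →
    grow (false , S) (true , P′) (∁ S) B₂ λ B₂′ →
    grow (true , P′ ∪ B₂′) (true , P′ ∪ B₂′) (S ∩ ∁ P′) R λ R′ →
    -- The test for a gap of at most `∣ S ∣ / k`, with the division cleared.
    if k * ∣ B₁′ ∣ ≤ᵇ k * ∣ B₂′ ∣ + ∣ S ∣ then finish P′ R′ B₁′ B₂′ else rounds k f S P′ R′ B₁′ B₂′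

  approximate : ℕ → (n : ℕ) → OracleAlg n
  approximate k n = grow (true , ⊥) (false , ⊥) ⊤ ⊥ λ S → rounds k k S S ⊥ ⊥ ⊥

  roundsCost : (n fuel : ℕ) → ℕ
  roundsCost n zero = n * 2
  roundsCost n (suc f) = n * 2 + (n * 2 + (n * 2 + (n * 2 + (n * 2 + roundsCost n f))))

  n*2≤roundsCost : ∀ n f → n * 2 ≤ roundsCost n f
  n*2≤roundsCost n zero = ≤-refl
  n*2≤roundsCost n (suc f) = m≤m+n _ _

  -- The separate `n * 2` pays for the greedy `S` and the base case for `finish`, which gives the 4;
  -- each round has five growths.
  roundsCost≡ : ∀ n f → n * 2 + roundsCost n f ≡ n * (10 * f + 4)
  roundsCost≡ n zero = base n
    where
    base : ∀ n → n * 2 + n * 2 ≡ n * 4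
    base = solve-∀
  roundsCost≡ n (suc f) = trans (cong (λ x → n * 2 + (n * 2 + (n * 2 + (n * 2 + (n * 2 + x))))) (roundsCost≡ n f)) (step n f)
    where
    step : ∀ n f → n * 2 + (n * 2 + (n * 2 + (n * 2 + (n * 2 + n * (10 * f + 4))))) ≡ n * (10 * suc f + 4)
    step = solve-∀

  -- The certificate is scaled by `k`; replacing `k * b₁` by `k * b₂ + s` leaves `3 * k` copies of
  -- `s + b₂`, plus `s`.
  gap-bound : ∀ {k o s b₁ b₂ z} → 2 * o ≤ 3 * s + (b₁ + 2 * b₂) → k * b₁ ≤ k * b₂ + s → s + b₂ ≤ z →
    2 * k * o ≤ 3 * k * z + s
  gap-bound {k} {o} {s} {b₁} {b₂} {z} cert gap size = begin
    2 * k * o                                   ≡⟨ e₁ k o ⟩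
    k * (2 * o)                                 ≤⟨ *-monoʳ-≤ k cert ⟩
    k * (3 * s + (b₁ + 2 * b₂))                 ≡⟨ e₂ k s b₁ b₂ ⟩
    k * b₁ + (3 * k * s + 2 * k * b₂)           ≤⟨ +-monoˡ-≤ _ gap ⟩
    k * b₂ + s + (3 * k * s + 2 * k * b₂)       ≡⟨ e₃ k s b₂ ⟩
    3 * k * (s + b₂) + s                        ≤⟨ +-monoˡ-≤ s (*-monoʳ-≤ (3 * k) size) ⟩
    3 * k * z + s                               ∎
    where
    open ≤-Reasoning
    e₁ : ∀ k o → 2 * k * o ≡ k * (2 * o)
    e₁ = solve-∀
    e₂ : ∀ k s b₁ b₂ → k * (3 * s + (b₁ + 2 * b₂)) ≡ k * b₁ + (3 * k * s + 2 * k * b₂)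
    e₂ = solve-∀
    e₃ : ∀ k s b₂ → k * b₂ + s + (3 * k * s + 2 * k * b₂) ≡ 3 * k * (s + b₂) + s
    e₃ = solve-∀

  -- A round that leaves a gap above s / k raises |R| by more than s / k, and |R| ≤ s;
  -- both sides are multiplied by k.
  budget-step : ∀ {k f s r b₁ r′ b₂} → k * b₂ + s < k * b₁ → r + b₁ ≤ r′ + b₂ →
    k * suc s ≤ k * r + suc f * suc s → k * suc s ≤ k * r′ + f * suc s
  budget-step {k} {f} {s} {r} {b₁} {r′} {b₂} gap progress budget = +-cancelʳ-≤ (k * b₂) _ _ (begin
    k * suc s + k * b₂                     ≤⟨ +-monoˡ-≤ (k * b₂) budget ⟩
    k * r + suc f * suc s + k * b₂         ≡⟨ e₁ k r f s b₂ ⟩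
    suc (k * b₂ + s) + (k * r + f * suc s) ≤⟨ +-monoˡ-≤ _ gap ⟩
    k * b₁ + (k * r + f * suc s)           ≡⟨ e₂ k b₁ r (f * suc s) ⟩
    k * (r + b₁) + f * suc s               ≤⟨ +-monoˡ-≤ _ (*-monoʳ-≤ k progress) ⟩
    k * (r′ + b₂) + f * suc s              ≡⟨ e₃ k r′ b₂ (f * suc s) ⟩
    k * r′ + f * suc s + k * b₂            ∎)
    where
    open ≤-Reasoning
    e₁ : ∀ k r f s b₂ → k * r + suc f * suc s + k * b₂ ≡ suc (k * b₂ + s) + (k * r + f * suc s)
    e₁ = solve-∀
    e₂ : ∀ k b₁ r x → k * b₁ + (k * r + x) ≡ k * (r + b₁) + x
    e₂ = solve-∀
    e₃ : ∀ k r′ b₂ x → k * (r′ + b₂) + x ≡ k * r′ + x + k * b₂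
    e₃ = solve-∀

  -- Correctness and query count

  module _ (M₁ M₂ : Matroid n) where

    -- The witness is the greedy set, existential because the output does not reveal it. Being
    -- common independent, it has size at most `r`, which makes the error relative to `r`.
    Approximates : ℕ → Subset n → Set
    Approximates k Z = Common M₁ M₂ Z × ∀ O → Common M₁ M₂ O → ∃ λ S → Common M₁ M₂ S ×
      2 * k * ∣ O ∣ ≤ 3 * k * ∣ Z ∣ + ∣ S ∣

    module _ {S : Subset n} (iS₁ : Indep M₁ S) (iS₂ : Indep M₂ S)
      (S-maximal : ∀ {y} → Indep M₁ (S ∪ ⁅ y ⁆) → Indep M₂ (S ∪ ⁅ y ⁆) → y ∈ S) where

      open FromMaximal M₁ M₂ iS₁ iS₂ S-maximal

      finish-terminates : ∀ {k P R B₁ B₂} → State P R B₁ B₂ →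
        (∀ O → Common M₁ M₂ O → 2 * ∣ O ∣ ≤ 3 * ∣ S ∣ + (∣ B₁ ∣ + 2 * ∣ B₂ ∣)) →
        k * ∣ B₁ ∣ ≤ k * ∣ B₂ ∣ + ∣ S ∣ →
        Terminates₂ M₁ M₂ (finish P R B₁ B₂) (Approximates k) (n * 2)
      finish-terminates {k} {P} {R} {B₁} {B₂} state cert gap =
        subst (Terminates₂ M₁ M₂ (finish P R B₁ B₂) (Approximates k)) (+-identityʳ (n * 2))
          (grow-terminates M₁ M₂ _ _ B₁ start-a start-a λ A₁ ga →
            (augmented-common ga , λ O cO → S , (iS₁ , iS₂) , gap-bound {k} (cert O cO) gap (∣augmented∣≥ ga)) , z≤n)
        where open Round state

      -- The budget records that every failed test, a strict inequality, has raised `k * ∣ R ∣` by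
      -- at least `suc ∣ S ∣`. With no fuel left, `R` would have outgrown `S`.
      rounds-terminate : ∀ k .{{_ : NonZero k}} f {P R B₁ B₂} → State P R B₁ B₂ →
        k * suc (∣ S ∣) ≤ k * (∣ R ∣) + f * suc (∣ S ∣) →
        Terminates₂ M₁ M₂ (rounds k f S P R B₁ B₂) (Approximates k) (roundsCost n f)
      rounds-terminate k zero {R = R} state budget =
        contradiction (p⊆q⇒∣p∣≤∣q∣ (State.R⊆S state))
          (<⇒≱ (*-cancelˡ-≤ k (≤-trans budget (≤-reflexive (+-identityʳ (k * ∣ R ∣))))))
      rounds-terminate k (suc f) {P} {R} {B₁} {B₂} state budget =
        grow-terminates M₁ M₂ _ _ B₁ start-a start-a λ A₁ ga →
        grow-terminates M₁ M₂ _ _ (∁ S) (start-b₁ ga) (start-b₂ ga) λ B₁′ gb →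
        grow-terminates M₁ M₂ _ _ P (start-c ga gb) (start-c ga gb) λ P′ gc →
        grow-terminates M₁ M₂ _ _ (∁ S) iSB₂ (start-d ga gb gc) λ B₂′ gd →
        grow-terminates M₁ M₂ _ _ (S ∩ ∁ P′) (start-e ga gb gc gd) (start-e ga gb gc gd) λ R′ ge →
        continue (certificate ga gb gc gd) (next ga gb gc gd ge) (progress ga gb gc gd ge)
        where
        open State state
        open Round state
        continue : ∀ {P′ R′ B₁′ B₂′} →
          (∀ O → Common M₁ M₂ O → 2 * ∣ O ∣ ≤ 3 * ∣ S ∣ + (∣ B₁′ ∣ + 2 * ∣ B₂′ ∣)) →
          State P′ R′ B₁′ B₂′ → ∣ R ∣ + ∣ B₁′ ∣ ≤ ∣ R′ ∣ + ∣ B₂′ ∣ →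
          Terminates₂ M₁ M₂
            (if k * ∣ B₁′ ∣ ≤ᵇ k * ∣ B₂′ ∣ + ∣ S ∣ then finish P′ R′ B₁′ B₂′ else rounds k f S P′ R′ B₁′ B₂′)
            (Approximates k) (roundsCost n f)
        continue {B₁′ = B₁′} {B₂′ = B₂′} cert state′ prog
          with k * ∣ B₁′ ∣ ≤ᵇ k * ∣ B₂′ ∣ + ∣ S ∣ in eq
        ... | true = let t = finish-terminates {k} state′ cert (≤ᵇ⇒≤ _ _ (subst T (sym eq) _))
                     in Terminates.result t , ≤-trans (Terminates.cost t) (n*2≤roundsCost n f)
        ... | false = rounds-terminate k f state′
          (budget-step {k} {f} (≰⇒> (λ le → subst T eq (≤⇒≤ᵇ le))) prog budget)

    approximate-terminates : ∀ k .{{_ : NonZero k}} →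
      Terminates₂ M₁ M₂ (approximate k n) (Approximates k) (n * (10 * k + 4))
    approximate-terminates k = subst (Terminates₂ M₁ M₂ (approximate k n) (Approximates k)) (roundsCost≡ n k)
      (grow-terminates M₁ M₂ _ _ ⊤ (indep-⊥ M₁ (∪-lub id id)) (indep-⊥ M₂ (∪-lub id id)) λ S g →
        let iS₁ = down-closed M₁ (∪-right id) (sat₁ g)
            iS₂ = down-closed M₂ (∪-right id) (sat₂ g)
            S-maximal = λ {y} i₁ i₂ → maximal g {y} ∈⊤ (down-closed M₁ (∪-lub ⊥⊆ id) i₁) (down-closed M₂ (∪-lub ⊥⊆ id) i₂)
        in rounds-terminate iS₁ iS₂ S-maximal k k (FromMaximal.initial M₁ M₂ iS₁ iS₂ S-maximal)
             (m≤n+m _ (k * ∣ ⊥ {n = n} ∣)))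

  -- Passing to rationals

  toℚᵘ-ℕtoℚ : ∀ m → toℚᵘ (ℕtoℚ m) ℚᵘ.≃ mkℚᵘ (+ m) 0
  toℚᵘ-ℕtoℚ m = ℚ.toℚᵘ-fromℚᵘ (mkℚᵘ (+ m) 0)

  ℕtoℚ-mono : ∀ {a b} → a ≤ b → ℕtoℚ a ℚ.≤ ℕtoℚ b
  ℕtoℚ-mono {a} {b} a≤b = ℚ.toℚᵘ-cancel-≤ (begin
    toℚᵘ (ℕtoℚ a) ≃⟨ toℚᵘ-ℕtoℚ a ⟩
    mkℚᵘ (+ a) 0  ≤⟨ ℚᵘ.*≤* (ℤ.*-monoʳ-≤-nonNeg (+ 1) (ℤ.+≤+ a≤b)) ⟩
    mkℚᵘ (+ b) 0  ≃⟨ toℚᵘ-ℕtoℚ b ⟨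
    toℚᵘ (ℕtoℚ b) ∎)
    where open ℚᵘ.≤-Reasoning

  ℕtoℚ-* : ∀ a b → ℕtoℚ (a * b) ≡ ℕtoℚ a ℚ.* ℕtoℚ b
  ℕtoℚ-* a b = ℚ.toℚᵘ-injective (begin-equality
    toℚᵘ (ℕtoℚ (a * b))                 ≃⟨ toℚᵘ-ℕtoℚ (a * b) ⟩
    mkℚᵘ (+ (a * b)) 0                  ≡⟨ cong (λ x → mkℚᵘ x 0) (ℤ.pos-* a b) ⟩
    mkℚᵘ (+ a) 0 ℚᵘ.* mkℚᵘ (+ b) 0      ≃⟨ ℚᵘ.*-cong (toℚᵘ-ℕtoℚ a) (toℚᵘ-ℕtoℚ b) ⟨
    toℚᵘ (ℕtoℚ a) ℚᵘ.* toℚᵘ (ℕtoℚ b)    ≃⟨ ℚ.toℚᵘ-homo-* (ℕtoℚ a) (ℕtoℚ b) ⟨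
    toℚᵘ (ℕtoℚ a ℚ.* ℕtoℚ b)            ∎)
    where open ℚᵘ.≤-Reasoning

  nonNeg-ℕtoℚ : ∀ m → ℚ.NonNegative (ℕtoℚ m)
  nonNeg-ℕtoℚ m = ℚ.nonNegative (ℕtoℚ-mono (z≤n {m}))

  p≤q+r⇒p-r≤q : ∀ p q r → p ℚ.≤ q ℚ.+ r → p ℚ.- r ℚ.≤ q
  p≤q+r⇒p-r≤q p q r p≤q+r = begin
    p ℚ.- r              ≤⟨ ℚ.+-monoˡ-≤ (ℚ.- r) p≤q+r ⟩
    (q ℚ.+ r) ℚ.- r      ≡⟨ ℚ.+-assoc q r (ℚ.- r) ⟩
    q ℚ.+ (r ℚ.- r)      ≡⟨ cong (q ℚ.+_) (ℚ.+-inverseʳ r) ⟩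
    q ℚ.+ ℚ.0ℚ           ≡⟨ ℚ.+-identityʳ q ⟩
    q                    ∎
    where open ℚ.≤-Reasoning

  module _ (p d : ℕ) .(coprime : Coprime (suc p) (suc d)) where

    private
      ε ⅔ : ℚ
      ε = mkℚ +[1+ p ] d coprime
      ⅔ = (+ 2) ℚ./ 3

    -- The hypothesis is the conclusion multiplied by `3 * suc d`, as `ε` is `suc p` over `suc d`.
    ⅔r≤z+εr : ∀ r z → 2 * r * suc d ≤ 3 * z * suc d + 3 * suc p * r →
      ⅔ ℚ.* ℕtoℚ r ℚ.≤ ℕtoℚ z ℚ.+ ε ℚ.* ℕtoℚ r
    ⅔r≤z+εr r z le = ℚ.toℚᵘ-cancel-≤ (begin
      toℚᵘ (⅔ ℚ.* ℕtoℚ r)                                  ≃⟨ ℚ.toℚᵘ-homo-* ⅔ (ℕtoℚ r) ⟩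
      toℚᵘ ⅔ ℚᵘ.* toℚᵘ (ℕtoℚ r)                            ≃⟨ ℚᵘ.*-congˡ {toℚᵘ ⅔} (toℚᵘ-ℕtoℚ r) ⟩
      mkℚᵘ (+ 2) 2 ℚᵘ.* mkℚᵘ (+ r) 0                       ≤⟨ ℚᵘ.*≤* integers ⟩
      mkℚᵘ (+ z) 0 ℚᵘ.+ mkℚᵘ +[1+ p ] d ℚᵘ.* mkℚᵘ (+ r) 0  ≃⟨ ℚᵘ.+-cong (toℚᵘ-ℕtoℚ z) (ℚᵘ.*-congˡ {toℚᵘ ε} (toℚᵘ-ℕtoℚ r)) ⟨
      toℚᵘ (ℕtoℚ z) ℚᵘ.+ toℚᵘ ε ℚᵘ.* toℚᵘ (ℕtoℚ r)         ≃⟨ ℚᵘ.+-congʳ (toℚᵘ (ℕtoℚ z)) (ℚ.toℚᵘ-homo-* ε (ℕtoℚ r)) ⟨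
      toℚᵘ (ℕtoℚ z) ℚᵘ.+ toℚᵘ (ε ℚ.* ℕtoℚ r)               ≃⟨ ℚ.toℚᵘ-homo-+ (ℕtoℚ z) (ε ℚ.* ℕtoℚ r) ⟨
      toℚᵘ (ℕtoℚ z ℚ.+ ε ℚ.* ℕtoℚ r)                       ∎)
      where
      open ℚᵘ.≤-Reasoning
      naturals : 2 * r * (1 * (suc d * 1)) ≤ (z * (suc d * 1) + suc p * r * 1) * 3
      naturals = ≤-trans (≤-reflexive (lhs r (suc d))) (≤-trans le (≤-reflexive (rhs z (suc d) (suc p) r)))
        where
        lhs : ∀ r q → 2 * r * (1 * (q * 1)) ≡ 2 * r * q
        lhs = solve-∀
        rhs : ∀ z q p r → 3 * z * q + 3 * p * r ≡ (z * (q * 1) + p * r * 1) * 3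
        rhs = solve-∀
      integers : (+ 2) ℤ.* (+ r) ℤ.* (+ (1 * (suc d * 1))) ℤ.≤
        ((+ z) ℤ.* (+ (suc d * 1)) ℤ.+ (+[1+ p ] ℤ.* (+ r)) ℤ.* (+ 1)) ℤ.* (+ 3)
      integers rewrite sym (ℤ.pos-* 2 r) | sym (ℤ.pos-* (2 * r) (1 * (suc d * 1)))
        | sym (ℤ.pos-* z (suc d * 1)) | sym (ℤ.pos-* (suc p) r) | sym (ℤ.pos-* (suc p * r) 1)
        | sym (ℤ.pos-* (z * (suc d * 1) + suc p * r * 1) 3) = ℤ.+≤+ naturals

    ratio-bound : ∀ r z → 2 * r * suc d ≤ 3 * z * suc d + 3 * suc p * r →
      (⅔ ℚ.- ε) ℚ.* ℕtoℚ r ℚ.≤ ℕtoℚ z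
    ratio-bound r z le = begin
      (⅔ ℚ.- ε) ℚ.* ℕtoℚ r                     ≡⟨ ℚ.*-distribʳ-+ (ℕtoℚ r) ⅔ (ℚ.- ε) ⟩
      ⅔ ℚ.* ℕtoℚ r ℚ.+ (ℚ.- ε) ℚ.* ℕtoℚ r      ≡⟨ cong (⅔ ℚ.* ℕtoℚ r ℚ.+_) (ℚ.neg-distribˡ-* ε (ℕtoℚ r)) ⟨
      ⅔ ℚ.* ℕtoℚ r ℚ.- ε ℚ.* ℕtoℚ r            ≤⟨ p≤q+r⇒p-r≤q (⅔ ℚ.* ℕtoℚ r) (ℕtoℚ z) (ε ℚ.* ℕtoℚ r) (⅔r≤z+εr r z le) ⟩
      ℕtoℚ z                                   ∎
      where open ℚ.≤-Reasoning

    -- `k * suc p ≤ suc d` says that `k` is at most 1/ε, so `n * k` is at most n/ε.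
    cost-bound : ∀ (εpos : Positive ε) c n k m r l → m ≤ c * (n * k) → k * suc p ≤ suc d →
      ℕtoℚ m ℚ.≤ ℕtoℚ c ℚ.* (divPos (ℕtoℚ n) ε εpos ℚ.+ ℕtoℚ r ℚ.* ℕtoℚ l)
    cost-bound εpos c n k m r l m≤ kp≤q = begin
      ℕtoℚ m                                                           ≤⟨ ℕtoℚ-mono m≤ ⟩
      ℕtoℚ (c * (n * k))                                               ≡⟨ ℕtoℚ-* c (n * k) ⟩
      ℕtoℚ c ℚ.* ℕtoℚ (n * k)                                          ≡⟨ cong (ℕtoℚ c ℚ.*_) (ℕtoℚ-* n k) ⟩
      ℕtoℚ c ℚ.* (ℕtoℚ n ℚ.* ℕtoℚ k)                                   ≤⟨ scale c (scale n k≤1/ε) ⟩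
      ℕtoℚ c ℚ.* divPos (ℕtoℚ n) ε εpos                                ≡⟨ cong (ℕtoℚ c ℚ.*_) (ℚ.+-identityʳ (divPos (ℕtoℚ n) ε εpos)) ⟨
      ℕtoℚ c ℚ.* (divPos (ℕtoℚ n) ε εpos ℚ.+ ℚ.0ℚ)                     ≤⟨ scale c (ℚ.+-monoʳ-≤ (divPos (ℕtoℚ n) ε εpos) (ℕtoℚ-mono {0} {r * l} z≤n)) ⟩
      ℕtoℚ c ℚ.* (divPos (ℕtoℚ n) ε εpos ℚ.+ ℕtoℚ (r * l))             ≡⟨ cong (λ x → ℕtoℚ c ℚ.* (divPos (ℕtoℚ n) ε εpos ℚ.+ x)) (ℕtoℚ-* r l) ⟩
      ℕtoℚ c ℚ.* (divPos (ℕtoℚ n) ε εpos ℚ.+ ℕtoℚ r ℚ.* ℕtoℚ l)        ∎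
      where
      open ℚ.≤-Reasoning
      scale : ∀ a {x y} → x ℚ.≤ y → ℕtoℚ a ℚ.* x ℚ.≤ ℕtoℚ a ℚ.* y
      scale a = ℚ.*-monoˡ-≤-nonNeg (ℕtoℚ a) {{nonNeg-ℕtoℚ a}}
      k≤1/ε : ℕtoℚ k ℚ.≤ ℚ.1/ ε
      k≤1/ε = ℚ.toℚᵘ-cancel-≤ (ℚᵘ.≤-respˡ-≃ (ℚᵘ.≃-sym (toℚᵘ-ℕtoℚ k)) (ℚᵘ.*≤* integers))
        where
        integers : (+ k) ℤ.* (+[1+ p ]) ℤ.≤ (+[1+ d ]) ℤ.* (+ 1)
        integers rewrite sym (ℤ.pos-* k (suc p)) | *-identityʳ d = ℤ.+≤+ kp≤q

  -- Choice of the number of rounds, and assembly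

  ⌊q/p⌋-positive : ∀ q p .{{_ : NonZero p}} → p ≤ q → NonZero (q / p)
  ⌊q/p⌋-positive q p p≤q = >-nonZero (m≥n⇒m/n>0 p≤q)

  -- The remainder is below `p`, which is at most `q / p * p` as the quotient is positive. The third
  -- copy is slack, matching the coefficient in `ratio-from-gap`.
  q≤3⌊q/p⌋p : ∀ q p .{{_ : NonZero p}} → p ≤ q → q ≤ 3 * (q / p) * p
  q≤3⌊q/p⌋p q p p≤q = begin
    q                            ≡⟨ m≡m%n+[m/n]*n q p ⟩
    q % p + q / p * p            ≤⟨ +-monoˡ-≤ _ (<⇒≤ (m%n<n q p)) ⟩
    p + q / p * p                ≤⟨ +-monoˡ-≤ _ (m≤n*m p (q / p)) ⟩
    q / p * p + q / p * p        ≤⟨ +-monoʳ-≤ (q / p * p) (m≤m+n _ _) ⟩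
    q / p * p + (q / p * p + q / p * p) ≡⟨ collect (q / p) p ⟩
    3 * (q / p) * p              ∎
    where
    open ≤-Reasoning
    instance
      _ = ⌊q/p⌋-positive q p p≤q
    collect : ∀ k p → k * p + (k * p + k * p) ≡ 3 * k * p
    collect = solve-∀

  -- Dividing the gap by `3 * k` leaves an error of s/(3k), and `q ≤ 3 * k * p` bounds 1/(3k) by
  -- p/q.
  ratio-from-gap : ∀ k .{{_ : NonZero k}} {p q r s z} → s ≤ r → q ≤ 3 * k * p →
    2 * k * r ≤ 3 * k * z + s → 2 * r * q ≤ 3 * z * q + 3 * p * r
  ratio-from-gap k {p} {q} {r} {s} {z} s≤r q≤ gap = *-cancelˡ-≤ k (begin
    k * (2 * r * q)                    ≡⟨ e₁ k r q ⟩
    2 * k * r * q                      ≤⟨ *-monoˡ-≤ q gap ⟩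
    (3 * k * z + s) * q                ≡⟨ *-distribʳ-+ q (3 * k * z) s ⟩
    3 * k * z * q + s * q              ≤⟨ +-monoʳ-≤ (3 * k * z * q) (*-mono-≤ s≤r q≤) ⟩
    3 * k * z * q + r * (3 * k * p)    ≡⟨ e₂ k z q r p ⟩
    k * (3 * z * q + 3 * p * r)        ∎)
    where
    open ≤-Reasoning
    e₁ : ∀ k r q → k * (2 * r * q) ≡ 2 * k * r * q
    e₁ = solve-∀
    e₂ : ∀ k z q r p → 3 * k * z * q + r * (3 * k * p) ≡ k * (3 * z * q + 3 * p * r)
    e₂ = solve-∀

  Solves : (ε : ℚ) → Positive ε → ((n : ℕ) → OracleAlg n) → Set
  Solves ε εpos A = ∀ (n : ℕ) (M₁ M₂ : Matroid n) (r : ℕ) → IsMaxCommonSize M₁ M₂ r →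
    Common M₁ M₂ (run (A n) (indep M₁) (indep M₂))
    × ((((+ 2) ℚ./ 3) ℚ.- ε) ℚ.* ℕtoℚ r ℚ.≤ ℕtoℚ ∣ run (A n) (indep M₁) (indep M₂) ∣)
    × (ℕtoℚ (queries (A n) (indep M₁) (indep M₂))
      ℚ.≤ ℕtoℚ 14 ℚ.* (divPos (ℕtoℚ n) ε εpos ℚ.+ ℕtoℚ r ℚ.* ℕtoℚ ⌈log₂ r ⌉))

  module _ (p d : ℕ) .(coprime : Coprime (suc p) (suc d)) (εpos : Positive (mkℚ +[1+ p ] d coprime)) where

    -- Here `ε` is at least 1, so the required ratio is negative and the empty set works without
    -- queries.
    empty-solves : suc d ≤ suc p → Solves (mkℚ +[1+ p ] d coprime) εpos (λ _ → output ⊥)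
    empty-solves q≤p n M₁ M₂ r _ =
      (indep-⊥ M₁ id , indep-⊥ M₂ id) ,
      ratio-bound p d coprime r (∣ ⊥ {n = n} ∣) (begin
        2 * r * suc d                                  ≤⟨ *-mono-≤ (*-monoˡ-≤ r {2} {3} (s≤s (s≤s z≤n))) q≤p ⟩
        3 * r * suc p                                  ≡⟨ swap r (suc p) ⟩
        3 * suc p * r                                  ≤⟨ m≤n+m _ (3 * ∣ ⊥ {n = n} ∣ * suc d) ⟩
        3 * ∣ ⊥ {n = n} ∣ * suc d + 3 * suc p * r      ∎) ,
      cost-bound p d coprime εpos 14 n 0 0 r ⌈log₂ r ⌉ z≤n z≤n
      where
      open ≤-Reasoning
      swap : ∀ r p → 3 * r * p ≡ 3 * p * r
      swap = solve-∀

    approximate-solves : suc p ≤ suc d → Solves (mkℚ +[1+ p ] d coprime) εpos (approximate (suc d / suc p))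
    approximate-solves p≤q n M₁ M₂ r ((O , cO , ∣O∣≡r) , r-max) =
      let instance k≢0 = ⌊q/p⌋-positive (suc d) (suc p) p≤q
          k = suc d / suc p
          t = approximate-terminates M₁ M₂ k
          common , ratio = Terminates.result t
          S , cS , gap = ratio O cO
          z = ∣ run (approximate k n) (indep M₁) (indep M₂) ∣
      in common ,
         ratio-bound p d coprime r z
           (ratio-from-gap k (r-max S cS) (q≤3⌊q/p⌋p (suc d) (suc p) p≤q)
             (subst (λ o → 2 * k * o ≤ 3 * k * z + ∣ S ∣) ∣O∣≡r gap)) ,
         cost-bound p d coprime εpos 14 n k _ r ⌈log₂ r ⌉ (≤-trans (Terminates.cost t) (linear n k)) (m/n*n≤m (suc d) (suc p))
      where
      linear : ∀ n k .{{_ : NonZero k}} → n * (10 * k + 4) ≤ 14 * (n * k)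
      -- As `k` is at least 1, 4 is at most `4 * k`; hence the constant 14.
      linear n k = ≤-trans (*-monoʳ-≤ n (+-monoʳ-≤ (10 * k) (m≤m*n 4 k))) (≤-reflexive (collect n k))
        where
        collect : ∀ n k → n * (10 * k + 4 * k) ≡ 14 * (n * k)
        collect = solve-∀

  -- `suc d / suc p` is the floor of 1/ε, positive exactly when `ε` is at most 1, which explains the
  -- case split.
  solution : (ε : ℚ) (εpos : Positive ε) → ∃ (Solves ε εpos)
  solution (mkℚ +[1+ p ] d coprime) εpos with suc p ≤? suc d
  ... | yes p≤q = approximate (suc d / suc p) , approximate-solves p d coprime εpos p≤q
  ... | no p≰q = (λ _ → output ⊥) , empty-solves p d coprime εpos (<⇒≤ (≰⇒> p≰q))

open AugmentingSets using (solution)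
open import Data.Rational using (ℚ; Positive; _≤_; _*_; _+_; _-_; _/_)

theorem1 : ∃ λ (C : ℕ) → (ε : ℚ) → (εpos : Positive ε) →
    ∃ λ (A : (n : ℕ) → OracleAlg n) →
    ∀ (n : ℕ) (M₁ M₂ : Matroid n) (r : ℕ) → IsMaxCommonSize M₁ M₂ r →
    Common M₁ M₂ (run (A n) (indep M₁) (indep M₂))
    × ((((+ 2) / 3) - ε) * ℕtoℚ r ≤ ℕtoℚ ∣ run (A n) (indep M₁) (indep M₂) ∣)
    × (ℕtoℚ (queries (A n) (indep M₁) (indep M₂))
    ≤ ℕtoℚ C * (divPos (ℕtoℚ n) ε εpos + ℕtoℚ r * ℕtoℚ ⌈log₂ r ⌉))
theorem1 = 14 , solution
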